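{- If $\mathbf{A}$ is a dually hemimorphic semi-Nelson algebra, then $\mathbf{A}$ is isomorphic (as a dually hemimorphic semi-Nelson algebra) to $\mathbf{V_k(dsH(A))}$.
   Context: **Semi-Heyting algebra**: an algebra $\mathbf{H}=\langle H;\land,\lor,\Rightarrow,0,1\rangle$ of type $(2,2,2,0,0)$ such that $\langle H,\land,\lor,0,1\rangle$ is a bounded lattice and for all $x,y,z\in H$: $x\land(x\Rightarrow y)=x\land y$; $x\land(y\Rightarrow z)=x\land((x\land y)\Rightarrow(x\land z))$; $x\Rightarrow x=1$. **Dually hemimorphic semi-Heyting algebra**: an algebra $\langle H;\land,\lor,\Rightarrow,{}^\dagger,0,1\rangle$ whose reduct without ${}^\dagger$ is a semi-Heyting algebra and which satisfies $0^\dagger=1$, $1^\dagger=0$, $(x\land y)^\dagger=x^\dagger\lor y^\dagger$. **Semi-Nelson algebra**: an algebra $\mathbf{A}=\langle A;\land,\lor,\to,\sim,1\rangle$ of type $(2,2,2,1,0)$ such that, writing $x\to_N y:=x\to(x\land y)$, for all $x,y,z\in A$: (SN1) $x\land(x\lor y)=x$; (SN2) $x\land(y\lor z)=(z\land x)\lor(y\land x)$; (SN3) $\sim\sim x=x$; (SN4) $\sim(x\land y)=\sim x\lor\sim y$; (SN5) $x\land\sim x=(x\land\sim x)\land(y\lor\sim y)$; (SN6) $x\land(x\to_N y)=x\land(\sim x\lor y)$; (SN7) $x\to_N(y\to_N z)=(x\land y)\to_N z$; (SN8) $(x\to_N y)\to_N[(y\to_N x)\to_N[(x\to z)\to_N(y\to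 z)]]=1$; (SN9) $(x\to_N y)\to_N[(y\to_N x)\to_N[(z\to x)\to_N(z\to y)]]=1$; (SN10) $(\sim(x\to y))\to_N(x\land\sim y)=1$; (SN11) $(x\land\sim y)\to_N(\sim(x\to y))=1$. **Dually hemimorphic semi-Nelson algebra**: an algebra $\langle A;\land,\lor,\to,\sim,',1\rangle$ of type $(2,2,2,1,1,0)$ such that $\langle A;\land,\lor,\to,\sim,1\rangle$ is a semi-Nelson algebra and for all $x,y\in A$ (with $\sim x'$ meaning $\sim(x')$): (DSN1) $(\sim 1)'=1$; (DSN2) $1'\to(\sim 1)=1$; (DSN3) $((x\to y)\land(y\to x)\land x')\to_N((x\to y)\land(y\to x)\land y)'=1$; (DSN4) $\sim x'\to(\sim x\land(x'\to x))=1$; (DSN5) $(\sim x\land(x'\to x))\to\sim x'=1$; (DSN6) $(x\land y)'\to(x'\lor y')=1$; (DSN7) $(x'\lor y')\to(x\land y)'=1$. **Quotient $\mathbf{dsH(A)}$**: for a dually hemimorphic semi-Nelson algebra $\mathbf{A}$, put $x\equiv y$ iff $x\to y=1$ and $y\to x=1$. This is an equivalence relation compatible with $\land,\lor,\to,{}'$; $[\![x]\!]$ denotes the class of $x$. $\mathbf{dsH(A)}=\langle A/_\equiv;\cap,\cup,\Rightarrow,{}^\dagger,\bot,\top\rangle$ with $\bot=[\![\sim 1]\!]$, $\top=[\![1]\!]$, $[\![x]\!]\cap[\![y]\!]=[\![x\land y]\!]$, $[\![x]\!]\cup[\![y]\!]=[\![x\lor y]\!]$, $[\![x]\!]\Rightarrow[\![y]\!]=[\![x\to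 y]\!]$, $[\![x]\!]^\dagger=[\![x']\!]$; it is a dually hemimorphic semi-Heyting algebra. **$\mathbf{V_k(H)}$**: for a dually hemimorphic semi-Heyting algebra $\mathbf{H}$, $V_k(H)=\{(a,b)\in H^2:a\land b=0\}$ and $\mathbf{V_k(H)}=\langle V_k(H);\sqcap,\sqcup,\to,\sim,',\top\rangle$ with $(a,b)\sqcap(c,d)=(a\land c,b\lor d)$, $(a,b)\sqcup(c,d)=(a\lor c,b\land d)$, $(a,b)\to(c,d)=(a\Rightarrow c,a\land d)$, $\sim(a,b)=(b,a)$, $(a,b)'=(a^\dagger,b\land(a^\dagger\Rightarrow a))$, $\top=(1,0)$; it is a dually hemimorphic semi-Nelson algebra. -}

module Defs where

open import Algebra.Core using (Op₁; Op₂)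
import Algebra.Definitions as AlgebraDefinitions
open import Algebra.Lattice.Bundles using (Lattice)
import Algebra.Lattice.Properties.Lattice as LatticeProperties
open import Algebra.Lattice.Structures using (IsLattice)
import Algebra.Morphism.Definitions as MorphismDefinitions
open import Data.Product.Base using (Σ-syntax; ∃-syntax; _×_; _,_; proj₁; proj₂)
open import Data.Product.Relation.Binary.Pointwise.NonDependent
  using (Pointwise; ×-isEquivalence)
open import Function.Base using (_on_)
open import Function.Definitions using (Injective; Surjective)
open import Level using (Level; _⊔_; suc)
open import Relation.Binary.Bundles using (Setoid)
import Relation.Binary.Construct.On as On
open import Relation.Binary.Core using (Rel)
import Relation.Binary.Lattice as Order
import Relation.Binary.Lattice.Properties.DistributiveLattice as DistributiveProperties
import Relation.Binary.Lattice.Properties.HeytingAlgebra as HeytingProperties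
import Relation.Binary.Lattice.Properties.JoinSemilattice as JoinProperties
import Relation.Binary.Lattice.Properties.Lattice as OrderLatticeProperties
import Relation.Binary.Lattice.Properties.MeetSemilattice as MeetProperties
open import Relation.Binary.Morphism.Structures using (IsRelHomomorphism)
import Relation.Binary.Reasoning.PartialOrder as PosetReasoning
import Relation.Binary.Reasoning.Setoid as SetoidReasoning
open import Relation.Binary.Structures using (IsEquivalence)

private
  variable
    c ℓ c₁ ℓ₁ c₂ ℓ₂ : Level

-- Algebras live on setoids: equations are stated with _≈_, and every operation
-- carries a congruence law.  The quotient of an algebra by a congruence has the
-- same carrier and operations, with the congruence as its _≈_.

module _ {A : Set c} (_≈_ : Rel A ℓ) where

  open AlgebraDefinitions _≈_

  record IsSemiHeytingAlgebra
    (_∧_ _∨_ _⇒_ : Op₂ A) (⊥ ⊤ : A) : Set (c ⊔ ℓ) where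
    field
      isLattice   : IsLattice _≈_ _∨_ _∧_
      ∧-identityʳ : RightIdentity ⊤ _∧_
      ∨-identityʳ : RightIdentity ⊥ _∨_
      ⇒-cong      : Congruent₂ _⇒_
      ∧-⇒         : ∀ x y → (x ∧ (x ⇒ y)) ≈ (x ∧ y)
      ∧-⇒-∧       : ∀ x y z → (x ∧ (y ⇒ z)) ≈ (x ∧ ((x ∧ y) ⇒ (x ∧ z)))
      ⇒-refl      : ∀ x → (x ⇒ x) ≈ ⊤

  record IsDHSemiHeytingAlgebra
    (_∧_ _∨_ _⇒_ : Op₂ A) (_† : Op₁ A) (⊥ ⊤ : A) : Set (c ⊔ ℓ) where
    field
      isSemiHeytingAlgebra : IsSemiHeytingAlgebra _∧_ _∨_ _⇒_ ⊥ ⊤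
      †-cong               : Congruent₁ _†
      ⊥-†                  : (⊥ †) ≈ ⊤
      ⊤-†                  : (⊤ †) ≈ ⊥
      ∧-†                  : ∀ x y → ((x ∧ y) †) ≈ ((x †) ∨ (y †))

    open IsSemiHeytingAlgebra isSemiHeytingAlgebra public

  record IsSemiNelsonAlgebra
    (_∧_ _∨_ _⟶_ : Op₂ A) (∼_ : Op₁ A) (⊤ : A) : Set (c ⊔ ℓ) where

    infixr 5 _⟶ₙ_

    _⟶ₙ_ : Op₂ A
    x ⟶ₙ y = x ⟶ (x ∧ y)

    field
      isEquivalence : IsEquivalence _≈_
      ∧-cong        : Congruent₂ _∧_
      ∨-cong        : Congruent₂ _∨_
      ⟶-cong        : Congruent₂ _⟶_
      ∼-cong        : Congruent₁ ∼_
      sn1  : ∀ x y → (x ∧ (x ∨ y)) ≈ x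
      sn2  : ∀ x y z → (x ∧ (y ∨ z)) ≈ ((z ∧ x) ∨ (y ∧ x))
      sn3  : ∀ x → (∼ (∼ x)) ≈ x
      sn4  : ∀ x y → (∼ (x ∧ y)) ≈ ((∼ x) ∨ (∼ y))
      sn5  : ∀ x y → (x ∧ (∼ x)) ≈ ((x ∧ (∼ x)) ∧ (y ∨ (∼ y)))
      sn6  : ∀ x y → (x ∧ (x ⟶ₙ y)) ≈ (x ∧ ((∼ x) ∨ y))
      sn7  : ∀ x y z → (x ⟶ₙ (y ⟶ₙ z)) ≈ ((x ∧ y) ⟶ₙ z)
      sn8  : ∀ x y z →
             ((x ⟶ₙ y) ⟶ₙ ((y ⟶ₙ x) ⟶ₙ ((x ⟶ z) ⟶ₙ (y ⟶ z)))) ≈ ⊤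
      sn9  : ∀ x y z →
             ((x ⟶ₙ y) ⟶ₙ ((y ⟶ₙ x) ⟶ₙ ((z ⟶ x) ⟶ₙ (z ⟶ y)))) ≈ ⊤
      sn10 : ∀ x y → ((∼ (x ⟶ y)) ⟶ₙ (x ∧ (∼ y))) ≈ ⊤
      sn11 : ∀ x y → ((x ∧ (∼ y)) ⟶ₙ (∼ (x ⟶ y))) ≈ ⊤

    open IsEquivalence isEquivalence public

  record IsDHSemiNelsonAlgebra
    (_∧_ _∨_ _⟶_ : Op₂ A) (∼_ _′ : Op₁ A) (⊤ : A) : Set (c ⊔ ℓ) where
    field
      isSemiNelsonAlgebra : IsSemiNelsonAlgebra _∧_ _∨_ _⟶_ ∼_ ⊤
      ′-cong              : Congruent₁ _′

    open IsSemiNelsonAlgebra isSemiNelsonAlgebra public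

    field
      dsn1 : ((∼ ⊤) ′) ≈ ⊤
      dsn2 : ((⊤ ′) ⟶ (∼ ⊤)) ≈ ⊤
      dsn3 : ∀ x y →
             ((((x ⟶ y) ∧ (y ⟶ x)) ∧ (x ′)) ⟶ₙ ((((x ⟶ y) ∧ (y ⟶ x)) ∧ y) ′)) ≈ ⊤
      dsn4 : ∀ x → ((∼ (x ′)) ⟶ ((∼ x) ∧ ((x ′) ⟶ x))) ≈ ⊤
      dsn5 : ∀ x → (((∼ x) ∧ ((x ′) ⟶ x)) ⟶ (∼ (x ′))) ≈ ⊤
      dsn6 : ∀ x y → (((x ∧ y) ′) ⟶ ((x ′) ∨ (y ′))) ≈ ⊤
      dsn7 : ∀ x y → (((x ′) ∨ (y ′)) ⟶ ((x ∧ y) ′)) ≈ ⊤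

record DHSemiHeytingAlgebra c ℓ : Set (suc (c ⊔ ℓ)) where
  infix  4 _≈_
  infixr 5 _⇒_
  infixr 6 _∨_
  infixr 7 _∧_
  infix  9 _†
  field
    Carrier                : Set c
    _≈_                    : Rel Carrier ℓ
    _∧_ _∨_ _⇒_            : Op₂ Carrier
    _†                     : Op₁ Carrier
    ⊥ ⊤                    : Carrier
    isDHSemiHeytingAlgebra : IsDHSemiHeytingAlgebra _≈_ _∧_ _∨_ _⇒_ _† ⊥ ⊤

  open IsDHSemiHeytingAlgebra isDHSemiHeytingAlgebra public

record DHSemiNelsonAlgebra c ℓ : Set (suc (c ⊔ ℓ)) where
  infix  4 _≈_
  infixr 5 _⟶_
  infixr 6 _∨_
  infixr 7 _∧_
  infix  8 ∼_
  infix  9 _′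
  field
    Carrier               : Set c
    _≈_                   : Rel Carrier ℓ
    _∧_ _∨_ _⟶_           : Op₂ Carrier
    ∼_ _′                 : Op₁ Carrier
    ⊤                     : Carrier
    isDHSemiNelsonAlgebra : IsDHSemiNelsonAlgebra _≈_ _∧_ _∨_ _⟶_ ∼_ _′ ⊤

  open IsDHSemiNelsonAlgebra isDHSemiNelsonAlgebra public

module _ (A : DHSemiNelsonAlgebra c₁ ℓ₁) (B : DHSemiNelsonAlgebra c₂ ℓ₂) where

  private
    module A = DHSemiNelsonAlgebra A
    module B = DHSemiNelsonAlgebra B

  open MorphismDefinitions A.Carrier B.Carrier B._≈_

  record IsDHSemiNelsonHomomorphism
    (⟦_⟧ : A.Carrier → B.Carrier) : Set (c₁ ⊔ ℓ₁ ⊔ ℓ₂) where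
    field
      isRelHomomorphism : IsRelHomomorphism A._≈_ B._≈_ ⟦_⟧
      ∧-homo            : Homomorphic₂ ⟦_⟧ A._∧_ B._∧_
      ∨-homo            : Homomorphic₂ ⟦_⟧ A._∨_ B._∨_
      ⟶-homo            : Homomorphic₂ ⟦_⟧ A._⟶_ B._⟶_
      ∼-homo            : Homomorphic₁ ⟦_⟧ A.∼_ B.∼_
      ′-homo            : Homomorphic₁ ⟦_⟧ A._′ B._′
      ⊤-homo            : Homomorphic₀ ⟦_⟧ A.⊤ B.⊤

  record IsDHSemiNelsonIsomorphism
    (⟦_⟧ : A.Carrier → B.Carrier) : Set (c₁ ⊔ ℓ₁ ⊔ c₂ ⊔ ℓ₂) where
    field
      isDHSemiNelsonHomomorphism : IsDHSemiNelsonHomomorphism ⟦_⟧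
      injective                  : Injective A._≈_ B._≈_ ⟦_⟧
      surjective                 : Surjective A._≈_ B._≈_ ⟦_⟧

  Isomorphic : Set (c₁ ⊔ ℓ₁ ⊔ c₂ ⊔ ℓ₂)
  Isomorphic = ∃[ f ] IsDHSemiNelsonIsomorphism f

module DHSemiNelsonProperties (𝐀 : DHSemiNelsonAlgebra c ℓ) where

  open DHSemiNelsonAlgebra 𝐀 hiding (reflexive)

  setoid : Setoid c ℓ
  setoid = record { isEquivalence = isEquivalence }

  private
    module ≈ = SetoidReasoning setoid

  -- Sholander: sn1 and sn2 axiomatise distributive lattices.

  ∧-∧-id : ∀ x → (x ∧ x) ∧ x ≈ x ∧ x
  ∧-∧-id x = begin
    (x ∧ x) ∧ x                  ≈⟨ ∧-cong refl x≈ ⟩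
    (x ∧ x) ∧ ((x ∧ x) ∨ x ∧ x)  ≈⟨ sn1 _ _ ⟩
    x ∧ x                        ∎
    where
    open ≈
    x≈ : x ≈ x ∧ x ∨ x ∧ x
    x≈ = trans (sym (sn1 x x)) (sn2 x x x)

  ∧-idem : ∀ x → x ∧ x ≈ x
  ∧-idem x = begin
    x ∧ x                          ≈⟨ ∧-cong refl x≈ ⟩
    x ∧ (x ∧ x ∨ x ∧ x)            ≈⟨ sn2 _ _ _ ⟩
    (x ∧ x) ∧ x ∨ (x ∧ x) ∧ x      ≈⟨ ∨-cong (∧-∧-id x) (∧-∧-id x) ⟩
    x ∧ x ∨ x ∧ x                  ≈⟨ x≈ ⟨
    x                              ∎
    where
    open ≈
    x≈ : x ≈ x ∧ x ∨ x ∧ x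
    x≈ = trans (sym (sn1 x x)) (sn2 x x x)

  ∨-idem : ∀ x → x ∨ x ≈ x
  ∨-idem x = begin
    x ∨ x            ≈⟨ ∨-cong (∧-idem x) (∧-idem x) ⟨
    x ∧ x ∨ x ∧ x    ≈⟨ sn2 x x x ⟨
    x ∧ (x ∨ x)      ≈⟨ sn1 x x ⟩
    x                ∎
    where open ≈

  ∧-comm : ∀ x y → x ∧ y ≈ y ∧ x
  ∧-comm x y = begin
    x ∧ y          ≈⟨ ∧-cong refl (∨-idem y) ⟨
    x ∧ (y ∨ y)    ≈⟨ sn2 _ _ _ ⟩
    y ∧ x ∨ y ∧ x  ≈⟨ ∨-idem _ ⟩
    y ∧ x          ∎
    where open ≈

  absorb₁ : ∀ x y → y ∧ x ∨ x ≈ x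
  absorb₁ x y = begin
    y ∧ x ∨ x      ≈⟨ ∨-cong refl (∧-idem x) ⟨
    y ∧ x ∨ x ∧ x  ≈⟨ sn2 _ _ _ ⟨
    x ∧ (x ∨ y)    ≈⟨ sn1 _ _ ⟩
    x              ∎
    where open ≈

  absorb₂ : ∀ x y → x ∨ y ∧ x ≈ x
  absorb₂ x y = begin
    x ∨ y ∧ x                ≈⟨ ∨-cong (∧-idem x) ∧-absorb ⟨
    x ∧ x ∨ (y ∧ x) ∧ x      ≈⟨ sn2 _ _ _ ⟨
    x ∧ (y ∧ x ∨ x)          ≈⟨ ∧-cong refl (absorb₁ x y) ⟩
    x ∧ x                    ≈⟨ ∧-idem x ⟩
    x                        ∎
    where
    open ≈
    ∧-absorb : (y ∧ x) ∧ x ≈ y ∧ x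
    ∧-absorb = trans (∧-cong refl (sym (absorb₁ x y))) (sn1 _ _)

  absorb₃ : ∀ x y → x ∧ (y ∨ x) ≈ x
  absorb₃ x y = begin
    x ∧ (y ∨ x)    ≈⟨ sn2 _ _ _ ⟩
    x ∧ x ∨ y ∧ x  ≈⟨ ∨-cong (∧-idem x) refl ⟩
    x ∨ y ∧ x      ≈⟨ absorb₂ x y ⟩
    x              ∎
    where open ≈

  ∨-comm : ∀ x y → x ∨ y ≈ y ∨ x
  ∨-comm x y = begin
    x ∨ y                      ≈⟨ ∧-idem _ ⟨
    (x ∨ y) ∧ (x ∨ y)          ≈⟨ sn2 _ _ _ ⟩
    y ∧ (x ∨ y) ∨ x ∧ (x ∨ y)  ≈⟨ ∨-cong (absorb₃ y x) (sn1 x y) ⟩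
    y ∨ x                      ∎
    where open ≈

  ∧-distribˡ-∨ : ∀ x y z → x ∧ (y ∨ z) ≈ x ∧ y ∨ x ∧ z
  ∧-distribˡ-∨ x y z =
    trans (sn2 x y z)
      (trans (∨-comm _ _) (∨-cong (∧-comm y x) (∧-comm z x)))

  ∨-assoc : ∀ x y z → (x ∨ y) ∨ z ≈ x ∨ (y ∨ z)
  ∨-assoc x y z = begin
    p                                  ≈⟨ ∧-idem p ⟨
    p ∧ p                              ≈⟨ ∧-distribˡ-∨ _ _ _ ⟩
    p ∧ (x ∨ y) ∨ p ∧ z                ≈⟨ ∨-cong (∧-distribˡ-∨ _ _ _) refl ⟩
    (p ∧ x ∨ p ∧ y) ∨ p ∧ z            ≈⟨ ∨-cong (∨-cong (below x∧p x∧q) (below y∧p y∧q))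
                                                 (below z∧p z∧q) ⟩
    (q ∧ x ∨ q ∧ y) ∨ q ∧ z            ≈⟨ ∨-cong (∧-distribˡ-∨ _ _ _) refl ⟨
    q ∧ (x ∨ y) ∨ q ∧ z                ≈⟨ ∧-distribˡ-∨ _ _ _ ⟨
    q ∧ p                              ≈⟨ ∧-comm q p ⟩
    p ∧ q                              ≈⟨ ∧-distribˡ-∨ _ _ _ ⟩
    p ∧ x ∨ p ∧ (y ∨ z)                ≈⟨ ∨-cong refl (∧-distribˡ-∨ _ _ _) ⟩
    p ∧ x ∨ (p ∧ y ∨ p ∧ z)            ≈⟨ ∨-cong (trans (∧-comm p x) x∧p)
                                           (∨-cong (trans (∧-comm p y) y∧p)
                                                   (trans (∧-comm p z) z∧p)) ⟩
    q                                  ∎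
    where
    open ≈
    p q : Carrier
    p = (x ∨ y) ∨ z
    q = x ∨ (y ∨ z)

    below : ∀ {w} → w ∧ p ≈ w → w ∧ q ≈ w → p ∧ w ≈ q ∧ w
    below w∧p w∧q =
      trans (∧-comm _ _) (trans w∧p (trans (sym w∧q) (∧-comm _ _)))

    left : ∀ {w u v} → w ∧ u ≈ w → w ∧ (u ∨ v) ≈ w
    left {w} {u} {v} w∧u = trans (∧-distribˡ-∨ w u v)
      (trans (∨-cong w∧u (∧-comm w v)) (absorb₂ w v))

    right : ∀ {w u v} → w ∧ v ≈ w → w ∧ (u ∨ v) ≈ w
    right w∧v = trans (∧-cong refl (∨-comm _ _)) (left w∧v)

    x∧p : x ∧ p ≈ x
    x∧p = left (sn1 x y)
    y∧p : y ∧ p ≈ y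
    y∧p = left (absorb₃ y x)
    z∧p : z ∧ p ≈ z
    z∧p = absorb₃ z (x ∨ y)
    x∧q : x ∧ q ≈ x
    x∧q = sn1 x (y ∨ z)
    y∧q : y ∧ q ≈ y
    y∧q = right (sn1 y z)
    z∧q : z ∧ q ≈ z
    z∧q = right (absorb₃ z y)

  ∧-via-∨ : ∀ x y → x ∧ y ≈ ∼ (∼ x ∨ ∼ y)
  ∧-via-∨ x y = trans (sym (sn3 _)) (∼-cong (sn4 x y))

  ∼-∨ : ∀ x y → ∼ (x ∨ y) ≈ ∼ x ∧ ∼ y
  ∼-∨ x y = sym (trans (∧-via-∨ _ _) (∼-cong (∨-cong (sn3 x) (sn3 y))))

  ∧-assoc : ∀ x y z → (x ∧ y) ∧ z ≈ x ∧ (y ∧ z)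
  ∧-assoc x y z = begin
    (x ∧ y) ∧ z              ≈⟨ ∧-via-∨ _ _ ⟩
    ∼ (∼ (x ∧ y) ∨ ∼ z)      ≈⟨ ∼-cong (∨-cong (sn4 x y) refl) ⟩
    ∼ ((∼ x ∨ ∼ y) ∨ ∼ z)    ≈⟨ ∼-cong (∨-assoc _ _ _) ⟩
    ∼ (∼ x ∨ (∼ y ∨ ∼ z))    ≈⟨ ∼-cong (∨-cong refl (sn4 y z)) ⟨
    ∼ (∼ x ∨ ∼ (y ∧ z))      ≈⟨ ∧-via-∨ _ _ ⟨
    x ∧ (y ∧ z)              ∎
    where open ≈

  lattice : Lattice c ℓ
  lattice = record
    { isLattice = record
      { isEquivalence = isEquivalence
      ; ∨-comm        = ∨-comm
      ; ∨-assoc       = ∨-assoc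
      ; ∨-cong        = ∨-cong
      ; ∧-comm        = ∧-comm
      ; ∧-assoc       = ∧-assoc
      ; ∧-cong        = ∧-cong
      ; absorptive    = (λ x y → trans (∨-cong refl (∧-comm x y)) (absorb₂ x y)) , sn1
      }
    }

  orderLattice : Order.Lattice c ℓ ℓ
  orderLattice = LatticeProperties.∨-∧-orderTheoreticLattice lattice

  open Order.Lattice orderLattice public
    using (_≤_; poset; antisym; reflexive; x≤x∨y; y≤x∨y; ∨-least; x∧y≤x; x∧y≤y; ∧-greatest)
    renaming (trans to ≤-trans; refl to ≤-refl)
  open MeetProperties (Order.Lattice.meetSemilattice orderLattice) public
    using (∧-monotonic)
  open JoinProperties (Order.Lattice.joinSemilattice orderLattice) public
    using (∨-monotonic)

  ∼-antitone : ∀ {x y} → x ≤ y → ∼ y ≤ ∼ x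
  ∼-antitone {x} {y} x≤y = begin
    ∼ y            ≤⟨ y≤x∨y (∼ x) (∼ y) ⟩
    ∼ x ∨ ∼ y      ≈⟨ sn4 x y ⟨
    ∼ (x ∧ y)      ≈⟨ ∼-cong x≤y ⟨
    ∼ x            ∎
    where open PosetReasoning poset

  -- ⊤ is the greatest element.

  ⟶ₙ-refl : ∀ x → x ⟶ₙ x ≈ x ⟶ x
  ⟶ₙ-refl x = ⟶-cong refl (∧-idem x)

  ⟶ₙ-cong : ∀ {x y u v} → x ≈ y → u ≈ v → x ⟶ₙ u ≈ y ⟶ₙ v
  ⟶ₙ-cong x≈y u≈v = ⟶-cong x≈y (∧-cong x≈y u≈v)

  ⟶ₙ-contract : ∀ x y → x ⟶ₙ (x ⟶ₙ y) ≈ x ⟶ₙ y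
  ⟶ₙ-contract x y = trans (sn7 x x y) (⟶ₙ-cong (∧-idem x) refl)

  x≤x⟶x : ∀ x → x ≤ x ⟶ x
  x≤x⟶x x = sym (begin
    x ∧ (x ⟶ x)    ≈⟨ ∧-cong refl (⟶ₙ-refl x) ⟨
    x ∧ (x ⟶ₙ x)   ≈⟨ sn6 x x ⟩
    x ∧ (∼ x ∨ x)  ≈⟨ absorb₃ x (∼ x) ⟩
    x              ∎)
    where open ≈

  [x⟶x]⟶ₙ[u⟶u] : ∀ x z → (x ⟶ x) ⟶ₙ ((x ⟶ z) ⟶ (x ⟶ z)) ≈ ⊤
  [x⟶x]⟶ₙ[u⟶u] x z = begin
    (x ⟶ x) ⟶ₙ (u ⟶ u)                          ≈⟨ ⟶ₙ-contract _ _ ⟨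
    (x ⟶ x) ⟶ₙ ((x ⟶ x) ⟶ₙ (u ⟶ u))             ≈⟨ ⟶ₙ-cong (⟶ₙ-refl x)
                                                     (⟶ₙ-cong (⟶ₙ-refl x) (⟶ₙ-refl u)) ⟨
    (x ⟶ₙ x) ⟶ₙ ((x ⟶ₙ x) ⟶ₙ (u ⟶ₙ u))          ≈⟨ sn8 x x z ⟩
    ⊤                                           ∎
    where
    open ≈
    u : Carrier
    u = x ⟶ z

  [x⟶x]⟶[x⟶x] : ∀ x → (x ⟶ x) ⟶ (x ⟶ x) ≈ ⊤
  [x⟶x]⟶[x⟶x] x = begin
    e ⟶ e               ≈⟨ ⟶ₙ-refl e ⟨
    e ⟶ₙ e              ≈⟨ ⟶ₙ-contract e e ⟨
    e ⟶ₙ (e ⟶ₙ e)       ≈⟨ ⟶ₙ-cong refl (⟶ₙ-refl e) ⟩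
    e ⟶ₙ (e ⟶ e)        ≈⟨ [x⟶x]⟶ₙ[u⟶u] x x ⟩
    ⊤                   ∎
    where
    open ≈
    e : Carrier
    e = x ⟶ x

  maximum : ∀ x → x ≤ ⊤
  maximum x = begin
    x                  ≤⟨ x≤x⟶x x ⟩
    x ⟶ x              ≤⟨ x≤x⟶x (x ⟶ x) ⟩
    (x ⟶ x) ⟶ (x ⟶ x)  ≈⟨ [x⟶x]⟶[x⟶x] x ⟩
    ⊤                  ∎
    where open PosetReasoning poset

  minimum : ∀ x → ∼ ⊤ ≤ x
  minimum x = ≤-trans (∼-antitone (maximum (∼ x))) (reflexive (sn3 x))

  ∧-identityˡ : ∀ x → ⊤ ∧ x ≈ x
  ∧-identityˡ x = antisym (x∧y≤y _ _) (∧-greatest (maximum x) ≤-refl)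

  ∧-identityʳ : ∀ x → x ∧ ⊤ ≈ x
  ∧-identityʳ x = trans (∧-comm x ⊤) (∧-identityˡ x)

  ⊤⟶ₙ : ∀ x → ⊤ ⟶ₙ x ≈ x
  ⊤⟶ₙ x = begin
    ⊤ ⟶ₙ x         ≈⟨ ∧-identityˡ _ ⟨
    ⊤ ∧ (⊤ ⟶ₙ x)   ≈⟨ sn6 ⊤ x ⟩
    ⊤ ∧ (∼ ⊤ ∨ x)  ≈⟨ ∧-identityˡ _ ⟩
    ∼ ⊤ ∨ x        ≈⟨ antisym (∨-least (minimum x) ≤-refl) (y≤x∨y _ _) ⟩
    x              ∎
    where open ≈

  ⊤⟶ : ∀ x → ⊤ ⟶ x ≈ x
  ⊤⟶ x = trans (⟶-cong refl (sym (∧-identityˡ x))) (⊤⟶ₙ x)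

  ⟶-refl : ∀ x → x ⟶ x ≈ ⊤
  ⟶-refl x = begin
    x ⟶ x                            ≈⟨ ⟶-cong (⊤⟶ x) (⊤⟶ x) ⟨
    (⊤ ⟶ x) ⟶ (⊤ ⟶ x)                ≈⟨ ⊤⟶ₙ _ ⟨
    ⊤ ⟶ₙ ((⊤ ⟶ x) ⟶ (⊤ ⟶ x))         ≈⟨ ⟶ₙ-cong (⊤⟶ ⊤) refl ⟨
    (⊤ ⟶ ⊤) ⟶ₙ ((⊤ ⟶ x) ⟶ (⊤ ⟶ x))   ≈⟨ [x⟶x]⟶ₙ[u⟶u] ⊤ x ⟩
    ⊤                                ∎
    where open ≈

  infix 4 _≼_ _≋_

  _≼_ : Rel Carrier ℓ
  x ≼ y = x ⟶ₙ y ≈ ⊤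

  _≋_ : Rel Carrier ℓ
  x ≋ y = x ⟶ y ≈ ⊤ × y ⟶ x ≈ ⊤

  ≼⇒≤ : ∀ {x y} → x ≼ y → x ≤ ∼ x ∨ y
  ≼⇒≤ {x} {y} x≼y = begin
    x               ≈⟨ ∧-identityʳ x ⟨
    x ∧ ⊤           ≈⟨ ∧-cong refl x≼y ⟨
    x ∧ (x ⟶ₙ y)    ≈⟨ sn6 x y ⟩
    x ∧ (∼ x ∨ y)   ∎
    where open ≈

  ≤⇒≼ : ∀ {x y} → x ≤ ∼ x ∨ y → x ≼ y
  ≤⇒≼ {x} {y} x≤∼x∨y = begin
    x ⟶ₙ y              ≈⟨ ⟶ₙ-contract x y ⟨
    x ⟶ x ∧ (x ⟶ₙ y)    ≈⟨ ⟶-cong refl (sn6 x y) ⟩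
    x ⟶ x ∧ (∼ x ∨ y)   ≈⟨ ⟶-cong refl x≤∼x∨y ⟨
    x ⟶ x               ≈⟨ ⟶-refl x ⟩
    ⊤                   ∎
    where open ≈

  ≤-≼ : ∀ {x y} → x ≤ y → x ≼ y
  ≤-≼ x≤y = ≤⇒≼ (≤-trans x≤y (y≤x∨y _ _))

  ≼-refl : ∀ {x} → x ≼ x
  ≼-refl = ≤-≼ ≤-refl

  ≼-trans : ∀ {x y z} → x ≼ y → y ≼ z → x ≼ z
  ≼-trans {x} {y} {z} x≼y y≼z = ≤⇒≼ (begin
    x                              ≤⟨ ∧-greatest ≤-refl (≼⇒≤ x≼y) ⟩
    x ∧ (∼ x ∨ y)                  ≤⟨ ∧-monotonic ≤-refl (∨-monotonic ≤-refl (≼⇒≤ y≼z)) ⟩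
    x ∧ (∼ x ∨ (∼ y ∨ z))          ≈⟨ ∧-distribˡ-∨ _ _ _ ⟩
    x ∧ ∼ x ∨ x ∧ (∼ y ∨ z)        ≈⟨ ∨-cong refl (∧-distribˡ-∨ _ _ _) ⟩
    x ∧ ∼ x ∨ (x ∧ ∼ y ∨ x ∧ z)    ≤⟨ ∨-least (≤-trans (x∧y≤y _ _) (x≤x∨y _ _))
                                        (∨-monotonic x∧∼y≤∼x (x∧y≤y _ _)) ⟩
    ∼ x ∨ z                        ∎)
    where
    open PosetReasoning poset
    x∧∼y≤∼x : x ∧ ∼ y ≤ ∼ x
    x∧∼y≤∼x = begin
      x ∧ ∼ y          ≈⟨ ∧-cong (sn3 x) refl ⟨
      ∼ ∼ x ∧ ∼ y      ≈⟨ ∼-∨ (∼ x) y ⟨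
      ∼ (∼ x ∨ y)      ≤⟨ ∼-antitone (≼⇒≤ x≼y) ⟩
      ∼ x              ∎

  ≼-∧ : ∀ {x y z} → x ≼ y → x ≼ z → x ≼ y ∧ z
  ≼-∧ {x} {y} {z} x≼y x≼z = ≤⇒≼ (begin
    x                                  ≤⟨ ∧-greatest (≼⇒≤ x≼y) (≼⇒≤ x≼z) ⟩
    (∼ x ∨ y) ∧ (∼ x ∨ z)              ≈⟨ ∧-distribˡ-∨ _ _ _ ⟩
    (∼ x ∨ y) ∧ ∼ x ∨ (∼ x ∨ y) ∧ z    ≤⟨ ∨-least (≤-trans (x∧y≤y _ _) (x≤x∨y _ _)) rest ⟩
    ∼ x ∨ y ∧ z                        ∎)
    where
    open PosetReasoning poset
    rest : (∼ x ∨ y) ∧ z ≤ ∼ x ∨ y ∧ z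
    rest = begin
      (∼ x ∨ y) ∧ z      ≈⟨ ∧-comm _ _ ⟩
      z ∧ (∼ x ∨ y)      ≈⟨ ∧-distribˡ-∨ _ _ _ ⟩
      z ∧ ∼ x ∨ z ∧ y    ≤⟨ ∨-monotonic (x∧y≤y _ _) (reflexive (∧-comm z y)) ⟩
      ∼ x ∨ y ∧ z        ∎

  ≼-∨ : ∀ {x y z} → x ≼ z → y ≼ z → x ∨ y ≼ z
  ≼-∨ {x} {y} {z} x≼z y≼z = ≤⇒≼ (begin
    x ∨ y                        ≤⟨ ∨-least
                                      (∧-greatest (≼⇒≤ x≼z) (cross x≼z y≼z))
                                      (∧-greatest (cross y≼z x≼z) (≼⇒≤ y≼z)) ⟩
    (∼ x ∨ z) ∧ (∼ y ∨ z)        ≈⟨ ∧-distribˡ-∨ _ _ _ ⟩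
    (∼ x ∨ z) ∧ ∼ y ∨ (∼ x ∨ z) ∧ z ≤⟨ ∨-least rest (≤-trans (x∧y≤y _ _) (y≤x∨y _ _)) ⟩
    ∼ x ∧ ∼ y ∨ z                ≈⟨ ∨-cong (∼-∨ x y) refl ⟨
    ∼ (x ∨ y) ∨ z                ∎)
    where
    open PosetReasoning poset
    rest : (∼ x ∨ z) ∧ ∼ y ≤ ∼ x ∧ ∼ y ∨ z
    rest = begin
      (∼ x ∨ z) ∧ ∼ y        ≈⟨ ∧-comm _ _ ⟩
      ∼ y ∧ (∼ x ∨ z)        ≈⟨ ∧-distribˡ-∨ _ _ _ ⟩
      ∼ y ∧ ∼ x ∨ ∼ y ∧ z    ≤⟨ ∨-monotonic (reflexive (∧-comm _ _)) (x∧y≤y _ _) ⟩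
      ∼ x ∧ ∼ y ∨ z          ∎

    cross : ∀ {x y} → x ≼ z → y ≼ z → x ≤ ∼ y ∨ z
    cross {x} {y} x≼z y≼z = begin
      x                                        ≤⟨ ∧-greatest ≤-refl (≼⇒≤ x≼z) ⟩
      x ∧ (∼ x ∨ z)                            ≈⟨ ∧-distribˡ-∨ _ _ _ ⟩
      x ∧ ∼ x ∨ x ∧ z                          ≤⟨ ∨-least kalman
                                                    (≤-trans (x∧y≤y _ _) (y≤x∨y _ _)) ⟩
      ∼ y ∨ z                                  ∎
      where
      kalman : x ∧ ∼ x ≤ ∼ y ∨ z
      kalman = begin
        x ∧ ∼ x      ≤⟨ ≤-trans (reflexive (sn5 x y)) (x∧y≤y _ _) ⟩
        y ∨ ∼ y      ≤⟨ ∨-least (≼⇒≤ y≼z) (x≤x∨y _ _) ⟩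
        ∼ y ∨ z      ∎

  ≼-curry : ∀ {x y z} → x ∧ y ≼ z → x ≼ y ⟶ₙ z
  ≼-curry = trans (sn7 _ _ _)

  ≼-uncurry : ∀ {x y z} → x ≼ y ⟶ₙ z → x ∧ y ≼ z
  ≼-uncurry = trans (sym (sn7 _ _ _))

  private
    detach : ∀ {w p q r s} → p ⟶ₙ (q ⟶ₙ (r ⟶ₙ s)) ≈ ⊤ → w ≼ p → w ≼ q → w ∧ r ≼ s
    detach pqrs w≼p w≼q =
      ≼-uncurry (≼-trans (≼-∧ ≼-refl w≼q) (≼-uncurry (≼-trans w≼p pqrs)))

  ⟶-replaceˡ : ∀ {w x y} z → w ∧ x ≼ y → w ∧ y ≼ x → w ∧ (x ⟶ z) ≼ y ⟶ z
  ⟶-replaceˡ z p q = detach (sn8 _ _ z) (≼-curry p) (≼-curry q)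

  ⟶-replaceʳ : ∀ {w x y} z → w ∧ x ≼ y → w ∧ y ≼ x → w ∧ (z ⟶ x) ≼ z ⟶ y
  ⟶-replaceʳ z p q = detach (sn9 _ _ z) (≼-curry p) (≼-curry q)

  ⟶-elim : ∀ x y → x ∧ (x ⟶ y) ≼ x ∧ y
  ⟶-elim x y = ≼-∧ (≤-≼ (x∧y≤x _ _)) (≼-trans (≼-∧ (≤-≼ (x∧y≤x _ _)) x∧[x⟶y]≼) x∧[x⟶ₙy]≼y)
    where
    x∧[x⟶y]≼ : x ∧ (x ⟶ y) ≼ x ⟶ₙ y
    x∧[x⟶y]≼ = ⟶-replaceʳ x ≼-refl (≤-≼ (≤-trans (x∧y≤y _ _) (x∧y≤y _ _)))
    x∧[x⟶ₙy]≼y : x ∧ (x ⟶ₙ y) ≼ y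
    x∧[x⟶ₙy]≼y = ≼-trans (≤-≼ (reflexive (∧-comm _ _))) (≼-uncurry ≼-refl)

  ⟶-intro : ∀ x y → x ∧ y ≼ x ∧ (x ⟶ y)
  ⟶-intro x y = ≼-∧ (≤-≼ (x∧y≤x _ _))
    (≼-trans (≼-∧ (≤-≼ (x∧y≤x _ _)) x∧y≼x⟶ₙy)
      (⟶-replaceʳ x (≤-≼ (≤-trans (x∧y≤y _ _) (x∧y≤y _ _))) ≼-refl))
    where
    x∧y≼x⟶ₙy : x ∧ y ≼ x ⟶ₙ y
    x∧y≼x⟶ₙy = ≼-curry (≤-≼ (≤-trans (x∧y≤x _ _) (x∧y≤y _ _)))

  ⟶⇒≼ : ∀ {x y} → x ⟶ y ≈ ⊤ → x ≼ y
  ⟶⇒≼ {x} {y} x⟶y = ≼-trans (≤-≼ (∧-greatest ≤-refl (≤-trans (maximum x) (reflexive (sym x⟶y)))))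
    (≼-trans (⟶-elim x y) (≤-≼ (x∧y≤y _ _)))

  ⊤≼⇒≈ : ∀ {x} → ⊤ ≼ x → x ≈ ⊤
  ⊤≼⇒≈ ⊤≼x = trans (sym (⊤⟶ₙ _)) ⊤≼x

  ≼-⟶ : ∀ {x y} → x ≼ y → y ≼ x → x ⟶ y ≈ ⊤
  ≼-⟶ {x} {y} x≼y y≼x = ⊤≼⇒≈
    (≼-trans (≤-≼ (∧-greatest ≤-refl (reflexive (sym (⟶-refl x)))))
      (⟶-replaceʳ x (≼-trans (≤-≼ (x∧y≤y _ _)) x≼y) (≼-trans (≤-≼ (x∧y≤y _ _)) y≼x)))

  ≼-antisym : ∀ {x y} → x ≼ y → y ≼ x → x ≋ y
  ≼-antisym x≼y y≼x = ≼-⟶ x≼y y≼x , ≼-⟶ y≼x x≼y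

  ≋⇒≼ : ∀ {x y} → x ≋ y → x ≼ y
  ≋⇒≼ (x⟶y , _) = ⟶⇒≼ x⟶y

  ≋⇒≽ : ∀ {x y} → x ≋ y → y ≼ x
  ≋⇒≽ (_ , y⟶x) = ⟶⇒≼ y⟶x

  ≋-isEquivalence : IsEquivalence _≋_
  ≋-isEquivalence = record
    { refl  = ≼-antisym ≼-refl ≼-refl
    ; sym   = λ (x⟶y , y⟶x) → y⟶x , x⟶y
    ; trans = λ p q → ≼-antisym (≼-trans (≋⇒≼ p) (≋⇒≼ q)) (≼-trans (≋⇒≽ q) (≋⇒≽ p))
    }

  quotientLattice : Order.Lattice c ℓ ℓ
  quotientLattice = record
    { _≈_ = _≋_
    ; _≤_ = _≼_
    ; _∨_ = _∨_
    ; _∧_ = _∧_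
    ; isLattice = record
      { isPartialOrder = record
        { isPreorder = record
          { isEquivalence = ≋-isEquivalence
          ; reflexive     = ≋⇒≼
          ; trans         = ≼-trans
          }
        ; antisym = ≼-antisym
        }
      ; supremum = λ x y → ≤-≼ (x≤x∨y x y) , ≤-≼ (y≤x∨y x y) , λ _ → ≼-∨
      ; infimum  = λ x y → ≤-≼ (x∧y≤x x y) , ≤-≼ (x∧y≤y x y) , λ _ → ≼-∧
      }
    }

  ⟶-cong-≋ : ∀ {x y u v} → x ≋ y → u ≋ v → x ⟶ u ≋ y ⟶ v
  ⟶-cong-≋ p q = ≼-antisym (mono p q) (mono (≋.sym p) (≋.sym q))
    where
    module ≋ = IsEquivalence ≋-isEquivalence
    under : ∀ {w x y} → x ≼ y → w ∧ x ≼ y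
    under = ≼-trans (≤-≼ (x∧y≤y _ _))
    mono : ∀ {x y u v} → x ≋ y → u ≋ v → x ⟶ u ≼ y ⟶ v
    mono {x} {y} {u} {v} p q =
      ≼-trans (≤-≼ (∧-greatest (maximum _) ≤-refl))
      (≼-trans (⟶-replaceˡ {⊤} u (under (≋⇒≼ p)) (under (≋⇒≽ p)))
      (≼-trans (≤-≼ (∧-greatest (maximum _) ≤-refl))
               (⟶-replaceʳ {⊤} y (under (≋⇒≼ q)) (under (≋⇒≽ q)))))

  ′-cong-≋ : ∀ {x y} → x ≋ y → x ′ ≋ y ′
  ′-cong-≋ (x⟶y , y⟶x) = ≼-antisym (mono x⟶y y⟶x) (mono y⟶x x⟶y)
    where
    mono : ∀ {x y} → x ⟶ y ≈ ⊤ → y ⟶ x ≈ ⊤ → x ′ ≼ y ′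
    mono {x} {y} x⟶y y⟶x = trans (sym (⟶ₙ-cong (drop (x ′)) (′-cong (drop y)))) (dsn3 x y)
      where
      drop : ∀ z → ((x ⟶ y) ∧ (y ⟶ x)) ∧ z ≈ z
      drop z = trans (∧-cong (trans (∧-cong x⟶y y⟶x) (∧-idem ⊤)) refl) (∧-identityˡ z)

dsH : DHSemiNelsonAlgebra c ℓ → DHSemiHeytingAlgebra c ℓ
dsH 𝐀 = record
  { Carrier = Carrier
  ; _≈_     = λ x y → x ⟶ y ≈ ⊤ × y ⟶ x ≈ ⊤
  ; _∧_     = _∧_
  ; _∨_     = _∨_
  ; _⇒_     = _⟶_
  ; _†      = _′
  ; ⊥       = ∼ ⊤
  ; ⊤       = ⊤
  ; isDHSemiHeytingAlgebra = record
    { isSemiHeytingAlgebra = record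
      { isLattice   = OrderLatticeProperties.isAlgLattice quotientLattice
      ; ∧-identityʳ = λ x →
          ≼-antisym (≤-≼ (x∧y≤x _ _)) (≤-≼ (∧-greatest ≤-refl (maximum x)))
      ; ∨-identityʳ = λ x →
          ≼-antisym (≤-≼ (∨-least ≤-refl (minimum x))) (≤-≼ (x≤x∨y _ _))
      ; ⇒-cong      = ⟶-cong-≋
      ; ∧-⇒         = λ x y → ≼-antisym (⟶-elim x y) (⟶-intro x y)
      ; ∧-⇒-∧       = relativise
      ; ⇒-refl      = λ x → ≼-antisym (≤-≼ (maximum _)) (≤-≼ (reflexive (sym (⟶-refl x))))
      }
    ; †-cong = ′-cong-≋
    ; ⊥-†    = ≼-antisym (≤-≼ (reflexive dsn1)) (≤-≼ (reflexive (sym dsn1)))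
    ; ⊤-†    = ≼-antisym (⟶⇒≼ dsn2) (≤-≼ (minimum _))
    ; ∧-†    = λ x y → dsn6 x y , dsn7 x y
    }
  }
  where
  open DHSemiNelsonAlgebra 𝐀 hiding (reflexive)
  open DHSemiNelsonProperties 𝐀

  relativise : ∀ x y z → x ∧ (y ⟶ z) ≋ x ∧ (x ∧ y ⟶ x ∧ z)
  relativise x y z = ≼-antisym
    (≼-∧ (≤-≼ (x∧y≤x _ _))
      (≼-trans (≼-∧ (≤-≼ (x∧y≤x _ _)) (⟶-replaceˡ z ≼-refl drop))
               (⟶-replaceʳ (x ∧ y) ≼-refl drop)))
    (≼-∧ (≤-≼ (x∧y≤x _ _))
      (≼-trans (≼-∧ (≤-≼ (x∧y≤x _ _)) (⟶-replaceˡ (x ∧ z) drop ≼-refl))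
               (⟶-replaceʳ y drop ≼-refl)))
    where
    drop : ∀ {w} → x ∧ (x ∧ w) ≼ w
    drop = ≤-≼ (≤-trans (x∧y≤y _ _) (x∧y≤y _ _))

module DHSemiHeytingProperties (𝐇 : DHSemiHeytingAlgebra c ℓ) where

  open DHSemiHeytingAlgebra 𝐇 public
  open IsLattice isLattice public hiding (reflexive)

  lattice : Lattice c ℓ
  lattice = record { isLattice = isLattice }

  orderLattice : Order.Lattice c ℓ ℓ
  orderLattice = LatticeProperties.∨-∧-orderTheoreticLattice lattice

  open Order.Lattice orderLattice public
    using ( setoid; _≤_; poset; antisym; reflexive; isPartialOrder; supremum; infimum
          ; x≤x∨y; y≤x∨y; ∨-least; x∧y≤x; x∧y≤y; ∧-greatest)
    renaming (trans to ≤-trans; refl to ≤-refl)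
  open MeetProperties (Order.Lattice.meetSemilattice orderLattice) public
    using (∧-monotonic)

  -- _⇒_ need not be residual to _∧_, but _⇨_ is.

  infixr 5 _⇨_

  _⇨_ : Op₂ Carrier
  x ⇨ y = x ⇒ (x ∧ y)

  maximum : ∀ x → x ≤ ⊤
  maximum x = sym (∧-identityʳ x)

  minimum : ∀ x → ⊥ ≤ x
  minimum x = ≤-trans (y≤x∨y x ⊥) (reflexive (∨-identityʳ x))

  ⇒-relativise : ∀ {w x y u v} → w ∧ x ≈ w ∧ y → w ∧ u ≈ w ∧ v →
                 w ∧ (x ⇒ u) ≈ w ∧ (y ⇒ v)
  ⇒-relativise {w} {x} {y} {u} {v} p q = begin
    w ∧ (x ⇒ u)          ≈⟨ ∧-⇒-∧ w x u ⟩
    w ∧ (w ∧ x ⇒ w ∧ u)  ≈⟨ ∧-cong refl (⇒-cong p q) ⟩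
    w ∧ (w ∧ y ⇒ w ∧ v)  ≈⟨ ∧-⇒-∧ w y v ⟨
    w ∧ (y ⇒ v)          ∎
    where open SetoidReasoning setoid

  residual-intro : ∀ {w x y} → w ∧ x ≤ y → w ≤ x ⇨ y
  residual-intro {w} {x} {y} w∧x≤y = begin
    w                        ≤⟨ ∧-greatest ≤-refl (maximum w) ⟩
    w ∧ ⊤                    ≈⟨ ∧-cong refl (⇒-refl x) ⟨
    w ∧ (x ⇒ x)              ≈⟨ ⇒-relativise refl w∧x≈ ⟩
    w ∧ (x ⇨ y)              ≤⟨ x∧y≤y _ _ ⟩
    x ⇨ y                    ∎
    where
    open PosetReasoning poset
    w∧x≈ : w ∧ x ≈ w ∧ (x ∧ y)
    w∧x≈ = trans w∧x≤y (∧-assoc w x y)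

  residual-elim : ∀ {w x y} → w ≤ x ⇨ y → w ∧ x ≤ y
  residual-elim {w} {x} {y} w≤x⇨y = begin
    w ∧ x          ≤⟨ ∧-monotonic w≤x⇨y ≤-refl ⟩
    (x ⇨ y) ∧ x    ≈⟨ ∧-comm _ _ ⟩
    x ∧ (x ⇨ y)    ≈⟨ ∧-⇒ x (x ∧ y) ⟩
    x ∧ (x ∧ y)    ≤⟨ ≤-trans (x∧y≤y _ _) (x∧y≤y _ _) ⟩
    y              ∎
    where open PosetReasoning poset

  heytingAlgebra : Order.HeytingAlgebra c ℓ ℓ
  heytingAlgebra = record
    { _⇨_ = _⇨_
    ; ⊤   = ⊤
    ; ⊥   = ⊥
    ; isHeytingAlgebra = record
      { isBoundedLattice = record
        { isLattice = Order.Lattice.isLattice orderLattice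
        ; maximum   = maximum
        ; minimum   = minimum
        }
      ; exponential = λ w x y → residual-intro , residual-elim
      }
    }

  open HeytingProperties heytingAlgebra public
    using (⇨-curry; ∧-distribˡ-∨; distributiveLattice)
  open DistributiveProperties distributiveLattice public
    using (∧-distribʳ-∨; ∨-distribˡ-∧)

  ≤⊥ : ∀ {x} → x ≤ ⊥ → x ≈ ⊥
  ≤⊥ x≤⊥ = antisym x≤⊥ (minimum _)

  ∨-⊥ : ∀ {x y} → x ≈ ⊥ → y ≈ ⊥ → x ∨ y ≈ ⊥
  ∨-⊥ x≈⊥ y≈⊥ = ≤⊥ (∨-least (reflexive x≈⊥) (reflexive y≈⊥))

  ∧-∨-⊥ : ∀ {x y z} → x ∧ y ≈ ⊥ → x ∧ z ≈ ⊥ → x ∧ (y ∨ z) ≈ ⊥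
  ∧-∨-⊥ p q = trans (∧-distribˡ-∨ _ _ _) (∨-⊥ p q)

  ⊥-mono : ∀ {x y u v} → x ≤ u → y ≤ v → u ∧ v ≈ ⊥ → x ∧ y ≈ ⊥
  ⊥-mono x≤u y≤v u∧v≈⊥ = ≤⊥ (≤-trans (∧-monotonic x≤u y≤v) (reflexive u∧v≈⊥))

  ⊥-swap : ∀ {x y} → x ∧ y ≈ ⊥ → y ∧ x ≈ ⊥
  ⊥-swap p = trans (∧-comm _ _) p

module VkConstruction (𝐇 : DHSemiHeytingAlgebra c ℓ) where

  open DHSemiHeytingProperties 𝐇

  V : Set (c ⊔ ℓ)
  V = Σ[ p ∈ Carrier × Carrier ] proj₁ p ∧ proj₂ p ≈ ⊥

  -- Elements of V are pairs: the proof of disjointness is irrelevant to equality.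
  _≈ᵥ_ : Rel V ℓ
  _≈ᵥ_ = Pointwise _≈_ _≈_ on proj₁

  _⊓_ : Op₂ V
  ((a , b) , p) ⊓ ((c , d) , q) = (a ∧ c , b ∨ d) ,
    ∧-∨-⊥ (⊥-mono (x∧y≤x _ _) ≤-refl p) (⊥-mono (x∧y≤y _ _) ≤-refl q)

  ∼ᵥ_ : Op₁ V
  ∼ᵥ ((a , b) , p) = (b , a) , ⊥-swap p

  _⊔ᵥ_ : Op₂ V
  ((a , b) , p) ⊔ᵥ ((c , d) , q) = (a ∨ c , b ∧ d) ,
    ⊥-swap (∧-∨-⊥ (⊥-mono (x∧y≤x _ _) ≤-refl (⊥-swap p))
                  (⊥-mono (x∧y≤y _ _) ≤-refl (⊥-swap q)))

  _⟶ᵥ_ : Op₂ V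
  ((a , b) , p) ⟶ᵥ ((c , d) , q) = (a ⇒ c , a ∧ d) ,
    ≤⊥ (begin
      (a ⇒ c) ∧ (a ∧ d)    ≈⟨ ∧-assoc _ _ _ ⟨
      ((a ⇒ c) ∧ a) ∧ d    ≈⟨ ∧-cong (∧-comm _ _) refl ⟩
      (a ∧ (a ⇒ c)) ∧ d    ≈⟨ ∧-cong (∧-⇒ a c) refl ⟩
      (a ∧ c) ∧ d          ≤⟨ ∧-monotonic (x∧y≤y _ _) ≤-refl ⟩
      c ∧ d                ≈⟨ q ⟩
      ⊥                    ∎)
    where open PosetReasoning poset

  _′ᵥ : Op₁ V
  ((a , b) , p) ′ᵥ = (a † , b ∧ (a † ⇒ a)) ,
    ≤⊥ (begin
      a † ∧ (b ∧ (a † ⇒ a))    ≤⟨ ∧-greatest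
                                    (∧-monotonic ≤-refl (x∧y≤y _ _))
                                    (≤-trans (x∧y≤y _ _) (x∧y≤x _ _)) ⟩
      (a † ∧ (a † ⇒ a)) ∧ b    ≈⟨ ∧-cong (∧-⇒ (a †) a) refl ⟩
      (a † ∧ a) ∧ b            ≤⟨ ∧-monotonic (x∧y≤y _ _) ≤-refl ⟩
      a ∧ b                    ≈⟨ p ⟩
      ⊥                        ∎)
    where open PosetReasoning poset

  ⊤ᵥ : V
  ⊤ᵥ = (⊤ , ⊥) , ≤⊥ (x∧y≤y _ _)

  private
    π : V → Carrier
    π x = proj₁ (proj₁ x)

  ⟶ᵥ-⊤ : ∀ x y → π x ≈ π y → (x ⟶ᵥ y) ≈ᵥ ⊤ᵥ
  ⟶ᵥ-⊤ ((a , b) , p) ((c , d) , q) a≈c =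
    trans (⇒-cong a≈c refl) (⇒-refl c) , trans (∧-cong a≈c refl) q

  ⟶ₙ-⊤ : ∀ x y → π x ≤ π y → (x ⟶ᵥ (x ⊓ y)) ≈ᵥ ⊤ᵥ
  ⟶ₙ-⊤ x y x≤y = ⟶ᵥ-⊤ x (x ⊓ y) x≤y

  isSemiNelsonAlgebra : IsSemiNelsonAlgebra _≈ᵥ_ _⊓_ _⊔ᵥ_ _⟶ᵥ_ ∼ᵥ_ ⊤ᵥ
  isSemiNelsonAlgebra = record
    { isEquivalence = On.isEquivalence proj₁ (×-isEquivalence isEquivalence isEquivalence)
    ; ∧-cong = λ (p , q) (r , s) → ∧-cong p r , ∨-cong q s
    ; ∨-cong = λ (p , q) (r , s) → ∨-cong p r , ∧-cong q s
    ; ⟶-cong = λ (p , q) (r , s) → ⇒-cong p r , ∧-cong p s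
    ; ∼-cong = λ (p , q) → q , p
    ; sn1    = λ _ _ → ∧-absorbs-∨ _ _ , ∨-absorbs-∧ _ _
    ; sn2    = λ _ _ _ → sn2₁ _ _ _ , sn2₂ _ _ _
    ; sn3    = λ _ → refl , refl
    ; sn4    = λ _ _ → refl , refl
    ; sn5    = sn5ᵥ
    ; sn6    = sn6ᵥ
    ; sn7    = sn7ᵥ
    ; sn8    = λ x y z → ⟶ₙ-⊤
        (x ⟶ₙ y) ((y ⟶ₙ x) ⟶ₙ ((x ⟶ᵥ z) ⟶ₙ (y ⟶ᵥ z)))
        (residual-intro (residual-intro (sn8₁ _ _ _)))
    ; sn9    = λ x y z → ⟶ₙ-⊤
        (x ⟶ₙ y) ((y ⟶ₙ x) ⟶ₙ ((z ⟶ᵥ x) ⟶ₙ (z ⟶ᵥ y)))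
        (residual-intro (residual-intro (sn9₁ _ _ _)))
    ; sn10   = λ x y → ⟶ₙ-⊤ (∼ᵥ (x ⟶ᵥ y)) (x ⊓ (∼ᵥ y)) ≤-refl
    ; sn11   = λ x y → ⟶ₙ-⊤ (x ⊓ (∼ᵥ y)) (∼ᵥ (x ⟶ᵥ y)) ≤-refl
    }
    where
    _⟶ₙ_ : Op₂ V
    x ⟶ₙ y = x ⟶ᵥ (x ⊓ y)

    module ≈ = SetoidReasoning setoid

    sn2₁ : ∀ x y z → x ∧ (y ∨ z) ≈ z ∧ x ∨ y ∧ x
    sn2₁ x y z = begin
      x ∧ (y ∨ z)      ≈⟨ ∧-comm _ _ ⟩
      (y ∨ z) ∧ x      ≈⟨ ∧-cong (∨-comm _ _) refl ⟩
      (z ∨ y) ∧ x      ≈⟨ ∧-distribʳ-∨ x z y ⟩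
      z ∧ x ∨ y ∧ x    ∎
      where open ≈

    sn2₂ : ∀ x y z → x ∨ (y ∧ z) ≈ (z ∨ x) ∧ (y ∨ x)
    sn2₂ x y z = begin
      x ∨ (y ∧ z)          ≈⟨ ∨-cong refl (∧-comm _ _) ⟩
      x ∨ (z ∧ y)          ≈⟨ ∨-distribˡ-∧ x z y ⟩
      (x ∨ z) ∧ (x ∨ y)    ≈⟨ ∧-cong (∨-comm _ _) (∨-comm _ _) ⟩
      (z ∨ x) ∧ (y ∨ x)    ∎
      where open ≈

    sn5ᵥ : ∀ x y → (x ⊓ (∼ᵥ x)) ≈ᵥ ((x ⊓ (∼ᵥ x)) ⊓ (y ⊔ᵥ (∼ᵥ y)))
    sn5ᵥ ((a , b) , p) ((c , d) , q) =
      trans p (sym (≤⊥ (≤-trans (x∧y≤x _ _) (reflexive p)))) ,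
      antisym (x≤x∨y _ _)
        (∨-least ≤-refl (≤-trans (reflexive (⊥-swap q)) (minimum _)))

    cancel : ∀ {a b d} → a ∧ b ≈ ⊥ → a ∧ (b ∨ d) ≈ a ∧ d
    cancel {a} {b} {d} p = trans (∧-distribˡ-∨ a b d)
      (antisym (∨-least (≤-trans (reflexive p) (minimum _)) ≤-refl) (y≤x∨y _ _))

    sn6ᵥ : ∀ x y → (x ⊓ (x ⟶ₙ y)) ≈ᵥ (x ⊓ ((∼ᵥ x) ⊔ᵥ y))
    sn6ᵥ ((a , b) , p) ((c , d) , q) =
      (begin
        a ∧ (a ⇒ a ∧ c)    ≈⟨ ∧-⇒ a (a ∧ c) ⟩
        a ∧ (a ∧ c)        ≈⟨ antisym (x∧y≤y _ _) (∧-greatest (x∧y≤x _ _) ≤-refl) ⟩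
        a ∧ c              ≈⟨ antisym (y≤x∨y _ _)
                                (∨-least (≤-trans (reflexive p) (minimum _)) ≤-refl) ⟩
        a ∧ b ∨ a ∧ c      ≈⟨ ∧-distribˡ-∨ a b c ⟨
        a ∧ (b ∨ c)        ∎) ,
      ∨-cong refl (cancel p)
      where
      open ≈

    sn7ᵥ : ∀ x y z → (x ⟶ₙ (y ⟶ₙ z)) ≈ᵥ ((x ⊓ y) ⟶ₙ z)
    sn7ᵥ ((a , b) , p) ((c , d) , q) ((e , f) , r) = sym ⇨-curry , (begin
      a ∧ (b ∨ c ∧ (d ∨ f))      ≈⟨ cancel p ⟩
      a ∧ (c ∧ (d ∨ f))          ≈⟨ ∧-cong refl (cancel q) ⟩
      a ∧ (c ∧ f)                ≈⟨ ∧-assoc a c f ⟨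
      (a ∧ c) ∧ f                ≈⟨ cancel (∧-∨-⊥ (⊥-mono (x∧y≤x _ _) ≤-refl p)
                                                  (⊥-mono (x∧y≤y _ _) ≤-refl q)) ⟨
      (a ∧ c) ∧ ((b ∨ d) ∨ f)    ∎)
      where
      open ≈

    same : ∀ a c → ((a ⇨ c) ∧ (c ⇨ a)) ∧ a ≈ ((a ⇨ c) ∧ (c ⇨ a)) ∧ c
    same a c = antisym
      (∧-greatest (x∧y≤x _ _) (residual-elim (x∧y≤x _ _)))
      (∧-greatest (x∧y≤x _ _) (residual-elim (x∧y≤y _ _)))

    sn8₁ : ∀ a c e → ((a ⇨ c) ∧ (c ⇨ a)) ∧ (a ⇒ e) ≤ c ⇒ e
    sn8₁ a c e = ≤-trans (reflexive (⇒-relativise (same a c) refl)) (x∧y≤y _ _)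

    sn9₁ : ∀ a c e → ((a ⇨ c) ∧ (c ⇨ a)) ∧ (e ⇒ a) ≤ e ⇒ c
    sn9₁ a c e = ≤-trans (reflexive (⇒-relativise refl (same a c))) (x∧y≤y _ _)

  isDHSemiNelsonAlgebra :
    IsDHSemiNelsonAlgebra _≈ᵥ_ _⊓_ _⊔ᵥ_ _⟶ᵥ_ ∼ᵥ_ _′ᵥ ⊤ᵥ
  isDHSemiNelsonAlgebra = record
    { isSemiNelsonAlgebra = isSemiNelsonAlgebra
    ; ′-cong = λ (p , q) → †-cong p , ∧-cong q (⇒-cong (†-cong p) p)
    ; dsn1   = ⊥-† , trans (∧-cong refl (⇒-cong ⊥-† refl))
                           (trans (∧-⇒ ⊤ ⊥) (≤⊥ (x∧y≤y _ _)))
    ; dsn2   = ⟶ᵥ-⊤ (⊤ᵥ ′ᵥ) (∼ᵥ ⊤ᵥ) ⊤-†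
    ; dsn3   = λ x y → ⟶ₙ-⊤ (((x ⟶ᵥ y) ⊓ (y ⟶ᵥ x)) ⊓ (x ′ᵥ))
                            ((((x ⟶ᵥ y) ⊓ (y ⟶ᵥ x)) ⊓ y) ′ᵥ)
                            (dsn3₁ _ _)
    ; dsn4   = λ x → ⟶ᵥ-⊤ (∼ᵥ (x ′ᵥ)) ((∼ᵥ x) ⊓ ((x ′ᵥ) ⟶ᵥ x)) refl
    ; dsn5   = λ x → ⟶ᵥ-⊤ ((∼ᵥ x) ⊓ ((x ′ᵥ) ⟶ᵥ x)) (∼ᵥ (x ′ᵥ)) refl
    ; dsn6   = λ x y → ⟶ᵥ-⊤ ((x ⊓ y) ′ᵥ) ((x ′ᵥ) ⊔ᵥ (y ′ᵥ)) (∧-† _ _)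
    ; dsn7   = λ x y → ⟶ᵥ-⊤ ((x ′ᵥ) ⊔ᵥ (y ′ᵥ)) ((x ⊓ y) ′ᵥ) (sym (∧-† _ _))
    }
    where
    dsn3₁ : ∀ a c → ((a ⇒ c) ∧ (c ⇒ a)) ∧ a † ≤ (((a ⇒ c) ∧ (c ⇒ a)) ∧ c) †
    dsn3₁ a c = begin
      e ∧ a †      ≤⟨ x∧y≤y _ _ ⟩
      a †          ≤⟨ y≤x∨y _ _ ⟩
      e † ∨ a †    ≈⟨ ∧-† e a ⟨
      (e ∧ a) †    ≈⟨ †-cong (antisym (∧-greatest (x∧y≤x _ _) (to (x∧y≤x _ _)))
                                      (∧-greatest (x∧y≤x _ _) (to (x∧y≤y _ _)))) ⟩
      (e ∧ c) †    ∎
      where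
      open PosetReasoning poset
      e : Carrier
      e = (a ⇒ c) ∧ (c ⇒ a)

      to : ∀ {w x y} → w ≤ x ⇒ y → w ∧ x ≤ y
      to {w} {x} {y} w≤ = begin
        w ∧ x          ≤⟨ ∧-monotonic w≤ ≤-refl ⟩
        (x ⇒ y) ∧ x    ≈⟨ ∧-comm _ _ ⟩
        x ∧ (x ⇒ y)    ≈⟨ ∧-⇒ x y ⟩
        x ∧ y          ≤⟨ x∧y≤y _ _ ⟩
        y              ∎

Vk : DHSemiHeytingAlgebra c ℓ → DHSemiNelsonAlgebra (c ⊔ ℓ) ℓ
Vk 𝐇 = record
  { Carrier = V
  ; _≈_     = _≈ᵥ_
  ; _∧_     = _⊓_
  ; _∨_     = _⊔ᵥ_
  ; _⟶_     = _⟶ᵥ_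
  ; ∼_      = ∼ᵥ_
  ; _′      = _′ᵥ
  ; ⊤       = ⊤ᵥ
  ; isDHSemiNelsonAlgebra = isDHSemiNelsonAlgebra
  }
  where open VkConstruction 𝐇

{-# OPTIONS --safe #-}

-- The isomorphism is x ↦ (⟦x⟧ , ⟦∼ x⟧).  It is onto because ⊤ ′ is a centre: dsn2 and dsn4
-- make both ⊤ ′ and ∼ (⊤ ′) vanish in dsH, so ⊤ ′ is sent to (⊥ , ⊥).  Joining a with ⊤ ′ then
-- kills its second coordinate, and when a ∧ b vanishes, meeting the result with
-- b ⟶ ∼ ⊤ ↦ (b ⇒ ⊥ , b) yields (a , b).

module Submission where

open import Data.Product.Base using (_,_)
open import Function.Definitions using (Injective; Surjective)
import Relation.Binary.Reasoning.PartialOrder as PosetReasoning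
open import Relation.Binary.Structures using (IsEquivalence)

open import Defs

module Representation {c ℓ} (𝐀 : DHSemiNelsonAlgebra c ℓ) where

  open DHSemiNelsonAlgebra 𝐀 hiding (reflexive)
  open DHSemiNelsonProperties 𝐀
  private
    module V = DHSemiNelsonAlgebra (Vk (dsH 𝐀))

  ≈⇒≼ : ∀ {x y} → x ≈ y → x ≼ y
  ≈⇒≼ x≈y = ≤-≼ (reflexive x≈y)

  ≈⇒≋ : ∀ {x y} → x ≈ y → x ≋ y
  ≈⇒≋ x≈y = ≼-antisym (≈⇒≼ x≈y) (≈⇒≼ (sym x≈y))

  ≋-refl : ∀ {x} → x ≋ x
  ≋-refl = ≈⇒≋ refl

  ≼∼⊤⇒≋∼⊤ : ∀ {x} → x ≼ ∼ ⊤ → x ≋ ∼ ⊤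
  ≼∼⊤⇒≋∼⊤ x≼∼⊤ = ≼-antisym x≼∼⊤ (≤-≼ (minimum _))

  -- By De Morgan, `∼ (x ∧ ∼ x)` contains `∼ x` as a joinand, so `≤⇒≼` applies. This is the
  -- disjointness that puts `(x , ∼ x)` in `V`.
  ∧-∼-≼∼⊤ : ∀ x → x ∧ ∼ x ≼ ∼ ⊤
  ∧-∼-≼∼⊤ x = ≤⇒≼ (begin
    x ∧ ∼ x                  ≤⟨ x∧y≤y _ _ ⟩
    ∼ x                      ≤⟨ x≤x∨y _ _ ⟩
    ∼ x ∨ ∼ ∼ x              ≈⟨ sn4 x (∼ x) ⟨
    ∼ (x ∧ ∼ x)              ≤⟨ x≤x∨y _ _ ⟩
    ∼ (x ∧ ∼ x) ∨ ∼ ⊤        ∎)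
    where open PosetReasoning poset

  represent : Carrier → V.Carrier
  represent x = (x , ∼ x) , ≼∼⊤⇒≋∼⊤ (∧-∼-≼∼⊤ x)

  ∼-⟶ : ∀ x y → ∼ (x ⟶ y) ≋ x ∧ ∼ y
  ∼-⟶ x y = ≼-antisym (sn10 x y) (sn11 x y)

  ∼-′ : ∀ x → ∼ (x ′) ≋ ∼ x ∧ (x ′ ⟶ x)
  ∼-′ x = dsn4 x , dsn5 x

  -- First coordinates agree by definition, so the content is in the second ones: they match up to
  -- `≈` for the lattice operations and `∼`, but only up to `≋` for `⟶` and `′`.
  represent-isHomomorphism : IsDHSemiNelsonHomomorphism 𝐀 (Vk (dsH 𝐀)) represent
  represent-isHomomorphism = record
    { isRelHomomorphism = record { cong = λ x≈y → ≈⇒≋ x≈y , ≈⇒≋ (∼-cong x≈y) }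
    ; ∧-homo            = λ x y → ≋-refl , ≈⇒≋ (sn4 x y)
    ; ∨-homo            = λ x y → ≋-refl , ≈⇒≋ (∼-∨ x y)
    ; ⟶-homo            = λ x y → ≋-refl , ∼-⟶ x y
    ; ∼-homo            = λ x → ≋-refl , ≈⇒≋ (sn3 x)
    ; ′-homo            = λ x → ≋-refl , ∼-′ x
    ; ⊤-homo            = ≋-refl , ≋-refl
    }

  -- From `x ≼ y` one gets `x ≤ ∼ x ∨ y`, so only `x ∧ ∼ x` remains to be bounded. The Kleene law
  -- `sn5` places it below `x ∧ (y ∨ ∼ y)`, and negating the inequality behind `∼ y ≼ ∼ x` absorbs
  -- `x ∧ ∼ y` into `y`.
  ≼∧∼≽⇒≤ : ∀ {x y} → x ≼ y → ∼ y ≼ ∼ x → x ≤ y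
  ≼∧∼≽⇒≤ {x} {y} x≼y ∼y≼∼x = begin
    x                          ≤⟨ ∧-greatest ≤-refl (≼⇒≤ x≼y) ⟩
    x ∧ (∼ x ∨ y)              ≈⟨ ∧-distribˡ-∨ _ _ _ ⟩
    x ∧ ∼ x ∨ x ∧ y            ≤⟨ ∨-least x∧∼x≤y (x∧y≤y _ _) ⟩
    y                          ∎
    where
    open PosetReasoning poset

    x∧∼y≤y : x ∧ ∼ y ≤ y
    x∧∼y≤y = begin
      x ∧ ∼ y                  ≈⟨ ∧-comm _ _ ⟩
      ∼ y ∧ x                  ≈⟨ ∧-cong refl (sn3 x) ⟨
      ∼ y ∧ ∼ ∼ x              ≈⟨ ∼-∨ y (∼ x) ⟨
      ∼ (y ∨ ∼ x)              ≈⟨ ∼-cong (∨-cong (sn3 y) refl) ⟨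
      ∼ (∼ ∼ y ∨ ∼ x)          ≤⟨ ∼-antitone (≼⇒≤ ∼y≼∼x) ⟩
      ∼ ∼ y                    ≈⟨ sn3 y ⟩
      y                        ∎

    x∧∼x≤y : x ∧ ∼ x ≤ y
    x∧∼x≤y = begin
      x ∧ ∼ x                  ≈⟨ sn5 x y ⟩
      (x ∧ ∼ x) ∧ (y ∨ ∼ y)    ≤⟨ ∧-monotonic (x∧y≤x _ _) ≤-refl ⟩
      x ∧ (y ∨ ∼ y)            ≈⟨ ∧-distribˡ-∨ _ _ _ ⟩
      x ∧ y ∨ x ∧ ∼ y          ≤⟨ ∨-least (x∧y≤y _ _) x∧∼y≤y ⟩
      y                        ∎

  represent-injective : Injective _≈_ V._≈_ represent
  represent-injective (x≋y , ∼x≋∼y) = antisym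
    (≼∧∼≽⇒≤ (≋⇒≼ x≋y) (≋⇒≽ ∼x≋∼y))
    (≼∧∼≽⇒≤ (≋⇒≽ x≋y) (≋⇒≼ ∼x≋∼y))

  ⊤′≼ : ∀ {x} → ⊤ ′ ≼ x
  ⊤′≼ = ≼-trans (⟶⇒≼ dsn2) (≤-≼ (minimum _))

  ∼⊤′≼ : ∀ {x} → ∼ (⊤ ′) ≼ x
  ∼⊤′≼ = ≼-trans (≋⇒≼ (∼-′ ⊤)) (≤-≼ (≤-trans (x∧y≤x _ _) (minimum _)))

  preimage : Carrier → Carrier → Carrier
  preimage a b = (a ∨ ⊤ ′) ∧ (b ⟶ ∼ ⊤)

  preimage-≋ : ∀ {a b} → a ∧ b ≼ ∼ ⊤ → preimage a b ≋ a
  preimage-≋ {a} {b} a∧b≼∼⊤ = ≼-antisym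
    (≼-trans (≤-≼ (x∧y≤x _ _)) (≼-∨ ≼-refl ⊤′≼))
    -- Currying the disjointness shows that the factor `b ⟶ ∼ ⊤` does not cut `a` down. Currying is
    -- a law of `⟶ₙ`, which agrees with `⟶` when the target is the least element.
    (≼-∧ (≤-≼ (x≤x∨y _ _)) (≼-trans (≼-curry a∧b≼∼⊤) (≈⇒≼ b⟶ₙ∼⊤)))
    where
    b⟶ₙ∼⊤ : b ⟶ₙ ∼ ⊤ ≈ b ⟶ ∼ ⊤
    b⟶ₙ∼⊤ = ⟶-cong refl (antisym (x∧y≤y _ _) (minimum _))

  -- De Morgan gives two joinands: `∼ a ∧ ∼ (⊤ ′)`, which vanishes in the quotient, and
  -- `∼ (b ⟶ ∼ ⊤)`, which is `b ∧ ∼ ∼ ⊤`, that is `b`.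
  ∼-preimage-≋ : ∀ a b → ∼ preimage a b ≋ b
  ∼-preimage-≋ a b = ≼-antisym
    (≼-trans (≈⇒≼ (sn4 _ _)) (≼-∨
      (≼-trans (≈⇒≼ (∼-∨ _ _)) (≼-trans (≤-≼ (x∧y≤y _ _)) ∼⊤′≼))
      (≼-trans (≋⇒≼ (∼-⟶ b (∼ ⊤))) (≤-≼ (x∧y≤x _ _)))))
    (≼-trans (≤-≼ (∧-greatest ≤-refl (≤-trans (maximum b) (reflexive (sym (sn3 ⊤))))))
      (≼-trans (≋⇒≽ (∼-⟶ b (∼ ⊤)))
        (≼-trans (≤-≼ (y≤x∨y _ _)) (≈⇒≼ (sym (sn4 _ _))))))

  represent-surjective : Surjective _≈_ V._≈_ represent
  -- `Surjective` asks this of every `z` equal to the witness, hence the transport along `z≈`.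
  represent-surjective ((a , b) , a∧b≋∼⊤) = preimage a b , λ z≈ →
    ≋.trans (≈⇒≋ z≈) (preimage-≋ (≋⇒≼ a∧b≋∼⊤)) ,
    ≋.trans (≈⇒≋ (∼-cong z≈)) (∼-preimage-≋ a b)
    where module ≋ = IsEquivalence ≋-isEquivalence

theorem4p6 : ∀ {c ℓ} (A : DHSemiNelsonAlgebra c ℓ) → Isomorphic A (Vk (dsH A))
theorem4p6 A = represent , record
  { isDHSemiNelsonHomomorphism = represent-isHomomorphism
  ; injective                  = represent-injective
  ; surjective                 = represent-surjective
  }
  where open Representation A
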